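{- For every $n\ge 3$, the diameter of the 1-skeleton of the polytope $\operatorname{PSB}(n)$ is at most $4$; that is, any two vertices of $\operatorname{PSB}(n)$ are joined by a path of at most $4$ edges of the 1-skeleton.
   Context: Let $K_n=(V,E)$ be the complete directed graph on the vertex set $V=\{1,\dots,n\}$ (cities), with arc set $E$ consisting of all ordered pairs $(u,v)$, $u\neq v$. A Hamiltonian tour $\tau$ is a directed cycle through all cities; $\tau(i)$ denotes the successor of city $i$, $\tau^{ -1}(i)$ its predecessor, and $\tau^{k}(i)$, $\tau^{ -k}(i)$ the $k$-th successor and $k$-th predecessor. A city $i$ is a peak if $\tau^{ -1}(i)<i$ and $\tau(i)<i$. A city $i$ is a step-back peak if either ($\tau^{ -1}(i)<i$, $\tau(i)=i-1$, $\tau^2(i)>i$) or ($\tau^{ -2}(i)>i$, $\tau^{ -1}(i)=i-1$, $\tau(i)<i$). A proper peak is a peak that is not a step-back peak. A pyramidal tour with step-backs is a Hamiltonian tour whose only proper peak is $n$. For a tour $x$, its characteristic vector $\mathbf{v}(x)\in\mathbb{R}^{E}$ has $\mathbf{v}(x)_e=1$ if the arc $e$ is used by $x$ and $0$ otherwise. The polytope of pyramidal tours with step-backs is $\operatorname{PSB}(n)=\operatorname{conv}\{\mathbf{v}(x) : x \text{ is a pyramidal tour with step-backs in } K_n\}$. The 1-skeleton of a polytope is the graph whose vertices are the vertices of the polytope and whose edges are the one-dimensional faces (geometric edges) of the polytope. The diameter of a graph is the maximum, over pairs of vertices, of the edge distance between them. -}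

module Defs where

open import Data.Nat using (ℕ; zero; suc; _∸_)
open import Data.Fin using (Fin; toℕ; _<_; _>_; _≟_)
open import Data.Rational using (ℚ; 0ℚ; 1ℚ; _+_; _*_) renaming (_<_ to _<ℚ_)
open import Data.Product using (Σ; ∃; _×_)
open import Relation.Nullary using (¬_; yes; no)
open import Relation.Binary.PropositionalEquality using (_≡_; _≢_; _≗_)
open import Function.Definitions using (Injective)

-- Cities 1..n are represented by Fin n (city i ↦ index i-1); the order is preserved.
-- A tour is given by its successor function τ.
Succ : ℕ → Set
Succ n = Fin n → Fin n

iter : ∀ {n} → Succ n → ℕ → Fin n → Fin n
iter τ zero    i = i
iter τ (suc k) i = τ (iter τ k i)

IsTour : ∀ {n} → Succ n → Set
IsTour {n} τ = Injective _≡_ _≡_ τ × (∀ (i j : Fin n) → ∃ λ k → iter τ k i ≡ j)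

Peak : ∀ {n} → Succ n → Fin n → Set
Peak τ i = (∃ λ p → τ p ≡ i × p < i) × τ i < i

StepBackPeak : ∀ {n} → Succ n → Fin n → Set
StepBackPeak τ i =
    ((∃ λ p → τ p ≡ i × p < i) × suc (toℕ (τ i)) ≡ toℕ i × τ (τ i) > i)
  Data.Sum.⊎
    ((∃ λ q → τ (τ q) ≡ i × q > i) × (∃ λ p → τ p ≡ i × suc (toℕ p) ≡ toℕ i) × τ i < i)
  where import Data.Sum

ProperPeak : ∀ {n} → Succ n → Fin n → Set
ProperPeak τ i = Peak τ i × ¬ StepBackPeak τ i

-- pyramidal tour with step-backs: the only proper peak is city n (index n-1)
IsPSB : ∀ {n} → Succ n → Set
IsPSB {n} τ = IsTour τ × (∀ (i : Fin n) → (ProperPeak τ i → toℕ i ≡ n ∸ 1)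
                                         × (toℕ i ≡ n ∸ 1 → ProperPeak τ i))

-- characteristic vector in ℚ^E, E = {(u,v) | u ≢ v}
charVec : ∀ {n} → Succ n → Fin n → Fin n → ℚ
charVec τ u v with τ u ≟ v
... | yes _ = 1ℚ
... | no  _ = 0ℚ

sumFin : ∀ {n} → (Fin n → ℚ) → ℚ
sumFin {zero}  f = 0ℚ
sumFin {suc n} f = f Fin.zero + sumFin (λ i → f (Fin.suc i))
  where import Data.Fin as Fin

dot : ∀ {n} → (Fin n → Fin n → ℚ) → (Fin n → Fin n → ℚ) → ℚ
dot c x = sumFin (λ u → sumFin (λ v → arc u v))
  where
  arc : _ → _ → ℚ
  arc u v with u ≟ v
  ... | yes _ = 0ℚ
  ... | no  _ = c u v * x u v

SameVec : ∀ {n} → Succ n → Succ n → Set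
SameVec {n} τ σ = ∀ (u v : Fin n) → charVec τ u v ≡ charVec σ u v

-- Distinct vertices v(τ), v(σ) of PSB(n) span an edge (1-dim face) of PSB(n):
-- there is a linear functional c maximized over PSB(n) exactly at v(τ) and v(σ).
Adjacent : ∀ {n} → Succ n → Succ n → Set
Adjacent {n} τ σ =
  IsPSB τ × IsPSB σ × ¬ (SameVec τ σ) ×
  Σ (Fin n → Fin n → ℚ) λ c →
    dot c (charVec τ) ≡ dot c (charVec σ) ×
    (∀ ρ → IsPSB ρ → ¬ (SameVec ρ τ) → ¬ (SameVec ρ σ) →
       dot c (charVec ρ) <ℚ dot c (charVec τ))

data PathLen {n : ℕ} : ℕ → Succ n → Succ n → Set where
  here : ∀ {k τ σ} → SameVec τ σ → PathLen k τ σ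
  step : ∀ {k τ ρ σ} → Adjacent τ ρ → PathLen k ρ σ → PathLen (suc k) τ σ

{-# OPTIONS --safe #-}

-- Two tours are adjacent as soon as no third tour is contained in the union of their arcs:
-- penalise the arcs outside the union.  For a tour x let θ be the involution exchanging i and
-- i - 1 for every step-back peak i.  The tour y = θ x⁻¹ θ runs backwards through x with its
-- step-backs sorted, so n is its only peak.  A tour inside x ∪ y keeps the direction it takes
-- at city 1, as turning around leads to a visited city; hence x and y are adjacent.  A tour
-- whose only peak is n is adjacent to the cyclic shift I = (1 2 … n), so I is at distance at
-- most 2 from every tour.
module Submission where

open import Defs
open import Data.Nat using (ℕ; _≤_; zero; suc; _+_; z≤n; s≤s; s≤s⁻¹)
import Data.Nat as ℕ
import Data.Nat.Properties as ℕ
open import Data.Nat.Induction using (<-rec)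
open import Data.Fin using (Fin; toℕ; fromℕ; fromℕ<; inject₁; _<_; _≟_; _<?_)
  renaming (zero to fzero; suc to fsuc)
open import Data.Fin.Properties
  using (toℕ-injective; toℕ<n; toℕ≤pred[n]; toℕ-fromℕ; toℕ-fromℕ<; toℕ-inject₁; any?; all?; ¬∀⟶∃¬; <-cmp)
open import Data.Product using (∃; _×_; _,_; proj₁; proj₂)
open import Data.Sum using (_⊎_; inj₁; inj₂; [_,_]′; swap)
open import Data.Empty using (⊥; ⊥-elim)
open import Data.Rational using (ℚ; 0ℚ; 1ℚ; -_; _*_)
  renaming (_≤_ to _≤ℚ_; _<_ to _<ℚ_)
import Data.Rational as ℚ
import Data.Rational.Properties as ℚ
open import Function using (_∘_)
open import Function.Definitions using (Injective)
open import Relation.Nullary using (¬_; Dec; yes; no; contradiction)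
open import Relation.Nullary.Decidable using (_×-dec_; _⊎-dec_; from-yes)
open import Relation.Binary.Definitions using (tri<; tri≈; tri>)
open import Relation.Binary.PropositionalEquality

-- Characteristic vectors and sums over arcs.

SameVec⇒≗ : ∀ {n} {τ σ : Succ n} → SameVec τ σ → τ ≗ σ
SameVec⇒≗ {τ = τ} {σ} same u with τ u ≟ τ u | σ u ≟ τ u | same u (τ u)
... | yes _ | yes eq | _  = sym eq
... | yes _ | no _   | ()
... | no ne | _      | _  = contradiction refl ne

≗⇒SameVec : ∀ {n} {τ σ : Succ n} → τ ≗ σ → SameVec τ σ
≗⇒SameVec {τ = τ} {σ} eq u v with τ u ≟ v | σ u ≟ v
... | yes _ | yes _ = refl
... | yes a | no b  = contradiction (trans (sym (eq u)) a) b
... | no a  | yes b = contradiction (trans (eq u) b) a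
... | no _  | no _  = refl

sumFin-cong : ∀ {n} {f g : Fin n → ℚ} → (∀ i → f i ≡ g i) → sumFin f ≡ sumFin g
sumFin-cong {zero}  eq = refl
sumFin-cong {suc n} eq = cong₂ ℚ._+_ (eq fzero) (sumFin-cong (eq ∘ fsuc))

sumFin-zero : ∀ {n} {f : Fin n → ℚ} → (∀ i → f i ≡ 0ℚ) → sumFin f ≡ 0ℚ
sumFin-zero {zero}  eq = refl
sumFin-zero {suc n} eq = cong₂ ℚ._+_ (eq fzero) (sumFin-zero (eq ∘ fsuc))

sumFin-nonpos : ∀ {n} {f : Fin n → ℚ} → (∀ i → f i ≤ℚ 0ℚ) → sumFin f ≤ℚ 0ℚ
sumFin-nonpos {zero}  le = ℚ.≤-refl
sumFin-nonpos {suc n} le = ℚ.+-mono-≤ (le fzero) (sumFin-nonpos (le ∘ fsuc))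

sumFin-neg : ∀ {n} {f : Fin n → ℚ} → (∀ i → f i ≤ℚ 0ℚ) → ∀ j → f j <ℚ 0ℚ → sumFin f <ℚ 0ℚ
sumFin-neg {suc n} le fzero    lt = ℚ.+-mono-<-≤ lt (sumFin-nonpos (le ∘ fsuc))
sumFin-neg {suc n} le (fsuc j) lt = ℚ.+-mono-≤-< (le fzero) (sumFin-neg (le ∘ fsuc) j lt)

-- The summand of dot is local to its definition; unification recovers a name for it.
mutual
  summand : ∀ {n} (c x : Fin n → Fin n → ℚ) → Fin n → Fin n → ℚ
  summand = _

  dot-summand : ∀ {n} (c x : Fin n → Fin n → ℚ) →
                dot c x ≡ sumFin (λ u → sumFin (λ v → summand c x u v))
  dot-summand c x = refl

dot-cong : ∀ {n} c {x y : Fin n → Fin n → ℚ} → (∀ u v → x u v ≡ y u v) → dot c x ≡ dot c y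
dot-cong {n} c {x} {y} eq = sumFin-cong {n} λ u → sumFin-cong {n} λ v → arc u v
  where
  arc : ∀ u v → summand c x u v ≡ summand c y u v
  arc u v with u ≟ v
  ... | yes _ = refl
  ... | no  _ = cong (c u v *_) (eq u v)

-- Rigid pairs and the penalty functional.

_⊆_∪_ : ∀ {n} → Succ n → Succ n → Succ n → Set
z ⊆ x ∪ y = ∀ u → z u ≡ x u ⊎ z u ≡ y u

-- `z` ranges over all tours, so the peaks of `z` never have to be examined.
Rigid : ∀ {n} → Succ n → Succ n → Set
Rigid x y = ∀ z → IsTour z → z ⊆ x ∪ y → z ≗ x ⊎ z ≗ y

-- With these weights a tour scores minus the number of its arcs outside the union of `x` and `y`.
penalty : ∀ {n} → Succ n → Succ n → Fin n → Fin n → ℚ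
penalty x y u v with x u ≟ v | y u ≟ v
... | yes _ | _     = 0ℚ
... | no  _ | yes _ = 0ℚ
... | no  _ | no  _ = - 1ℚ

dot-penaltyˡ : ∀ {n} (x y : Succ n) → dot (penalty x y) (charVec x) ≡ 0ℚ
dot-penaltyˡ {n} x y = sumFin-zero {n} λ u → sumFin-zero {n} λ v → arc u v
  where
  arc : ∀ u v → summand (penalty x y) (charVec x) u v ≡ 0ℚ
  arc u v with u ≟ v
  ... | yes _ = refl
  ... | no  _ with x u ≟ v | y u ≟ v
  ...   | yes _ | _     = refl
  ...   | no  _ | yes _ = refl
  ...   | no  _ | no  _ = refl

dot-penaltyʳ : ∀ {n} (x y : Succ n) → dot (penalty x y) (charVec y) ≡ 0ℚ
dot-penaltyʳ {n} x y = sumFin-zero {n} λ u → sumFin-zero {n} λ v → arc u v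
  where
  arc : ∀ u v → summand (penalty x y) (charVec y) u v ≡ 0ℚ
  arc u v with u ≟ v
  ... | yes _ = refl
  ... | no  _ with x u ≟ v | y u ≟ v
  ...   | yes _ | yes _ = refl
  ...   | yes _ | no _  = refl
  ...   | no  _ | yes _ = refl
  ...   | no  _ | no  _ = refl

-- Since `dot` skips the diagonal, `z u ≢ u` is what makes the stray arc count.
dot-penalty-neg : ∀ {n} (x y z : Succ n) u → z u ≢ u → z u ≢ x u → z u ≢ y u →
                  dot (penalty x y) (charVec z) <ℚ 0ℚ
dot-penalty-neg {n} x y z u₀ z≢id z≢x z≢y =
  sumFin-neg {n} (λ u → sumFin-nonpos {n} (arc≤ u)) u₀ (sumFin-neg {n} (arc≤ u₀) (z u₀) arc<)
  where
  arc≤ : ∀ u v → summand (penalty x y) (charVec z) u v ≤ℚ 0ℚ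
  arc≤ u v with u ≟ v
  ... | yes _ = ℚ.≤-refl
  ... | no  _ with x u ≟ v | y u ≟ v | z u ≟ v
  ...   | yes _ | _     | yes _ = ℚ.≤-refl
  ...   | yes _ | _     | no  _ = ℚ.≤-refl
  ...   | no  _ | yes _ | yes _ = ℚ.≤-refl
  ...   | no  _ | yes _ | no  _ = ℚ.≤-refl
  ...   | no  _ | no  _ | yes _ = from-yes (- 1ℚ ℚ.≤? 0ℚ)
  ...   | no  _ | no  _ | no  _ = ℚ.≤-refl

  arc< : summand (penalty x y) (charVec z) u₀ (z u₀) <ℚ 0ℚ
  arc< with u₀ ≟ z u₀
  ... | yes eq = contradiction (sym eq) z≢id
  ... | no  _ with x u₀ ≟ z u₀ | y u₀ ≟ z u₀ | z u₀ ≟ z u₀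
  ...   | yes eq | _      | _     = contradiction (sym eq) z≢x
  ...   | no  _  | yes eq | _     = contradiction (sym eq) z≢y
  ...   | no  _  | no  _  | yes _ = from-yes (- 1ℚ ℚ.<? 0ℚ)
  ...   | no  _  | no  _  | no ne = contradiction refl ne

-- Iterates and inverses of tours.

iter-comm : ∀ {n} (x : Succ n) k i → iter x k (x i) ≡ x (iter x k i)
iter-comm x zero    i = refl
iter-comm x (suc k) i = cong x (iter-comm x k i)

iter-+ : ∀ {n} (x : Succ n) a b i → iter x (a + b) i ≡ iter x a (iter x b i)
iter-+ x zero    b i = refl
iter-+ x (suc a) b i = cong x (iter-+ x a b i)

-- The trap principle behind the contradictions below: a tour cannot be caught in a set that misses
-- some city.
closed⇒all : ∀ {n} {x : Succ n} → IsTour x → (P : Fin n → Set) →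
             (∀ i → P i → P (x i)) → ∀ i → P i → ∀ j → P j
closed⇒all {x = x} (_ , reach) P closed i Pi j with reach i j
... | k , refl = along k
  where
  along : ∀ k → P (iter x k i)
  along zero    = Pi
  along (suc k) = closed _ (along k)

Inverse : ∀ {n} → Succ n → Succ n → Set
Inverse x p = (∀ i → x (p i) ≡ i) × (∀ i → p (x i) ≡ i)

Inverse-sym : ∀ {n} {x p : Succ n} → Inverse x p → Inverse p x
Inverse-sym (a , b) = b , a

tour-inverse : ∀ {n} {x : Succ n} → IsTour x → ∃ (Inverse x)
tour-inverse {x = x} (inj , reach) = p , xp , λ i → inj (xp (x i))
  where
  p : Succ _
  -- If `x j` reaches `j` in k steps, the city k steps after `j` is the predecessor of `j`, as `x`
  -- commutes with its iterates.
  p j = iter x (proj₁ (reach (x j) j)) j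
  xp : ∀ j → x (p j) ≡ j
  xp j = trans (sym (iter-comm x (proj₁ (reach (x j) j)) j)) (proj₂ (reach (x j) j))

inverse-tour : ∀ {n} {x p : Succ n} → Inverse x p → IsTour x → IsTour p
inverse-tour {x = x} {p} (xp , px) (_ , reach) =
  (λ {i} {j} eq → trans (sym (xp i)) (trans (cong x eq) (xp j))) ,
  λ i j → proj₁ (reach j i) ,
    trans (cong (iter p (proj₁ (reach j i))) (sym (proj₂ (reach j i)))) (back (proj₁ (reach j i)) j)
  where
  back : ∀ k j → iter p k (iter x k j) ≡ j
  back zero    j = refl
  back (suc k) j = trans (sym (iter-comm p k _))
    (trans (cong (iter p k) (px _)) (back k j))

module _ {m : ℕ} where

  private
    n : ℕ
    n = suc (suc (suc m))

  tour-no-fixpoint : {x : Succ n} → IsTour x → ∀ i → x i ≢ i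
  tour-no-fixpoint t i fix
    with closed⇒all t (_≡ i) (λ { _ refl → fix }) i refl
  ... | all with trans (all fzero) (sym (all (fsuc fzero)))
  ... | ()

  -- The cities `i` and `x i` would be closed under `x`, but three distinct cities do not fit into
  -- two places.
  tour-no-2-cycle : {x : Succ n} → IsTour x → ∀ i → x (x i) ≢ i
  tour-no-2-cycle {x} t i cyc = absurd (all fzero) (all (fsuc fzero)) (all (fsuc (fsuc fzero)))
    where
    all : ∀ j → j ≡ i ⊎ j ≡ x i
    all = closed⇒all t (λ j → j ≡ i ⊎ j ≡ x i)
            (λ { _ (inj₁ refl) → inj₂ refl ; _ (inj₂ refl) → inj₁ cyc }) i (inj₁ refl)
    differ : {a b c : Fin n} → a ≡ c → b ≡ c → a ≢ b → ⊥
    differ p q ne = ne (trans p (sym q))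
    absurd : ∀ {a b : Fin n} → fzero ≡ a ⊎ fzero ≡ b → fsuc fzero ≡ a ⊎ fsuc fzero ≡ b →
             fsuc (fsuc fzero) ≡ a ⊎ fsuc (fsuc fzero) ≡ b → ⊥
    absurd (inj₁ p) (inj₁ q) _        = differ p q λ ()
    absurd (inj₂ p) (inj₂ q) _        = differ p q λ ()
    absurd (inj₁ p) (inj₂ q) (inj₁ r) = differ p r λ ()
    absurd (inj₁ p) (inj₂ q) (inj₂ r) = differ q r λ ()
    absurd (inj₂ p) (inj₁ q) (inj₁ r) = differ q r λ ()
    absurd (inj₂ p) (inj₁ q) (inj₂ r) = differ p r λ ()

  -- From rigidity to edges and paths.

  rigid⇒adjacent : {x y : Succ n} → IsPSB x → IsPSB y → ¬ SameVec x y → Rigid x y → Adjacent x y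
  rigid⇒adjacent {x} {y} psbx psby ne rigid =
    psbx , psby , ne , penalty x y ,
    trans (dot-penaltyˡ x y) (sym (dot-penaltyʳ x y)) ,
    λ z psbz z≢x z≢y → subst (dot (penalty x y) (charVec z) <ℚ_) (sym (dot-penaltyˡ x y)) (below z psbz z≢x z≢y)
    where
    below : ∀ z → IsPSB z → ¬ SameVec z x → ¬ SameVec z y → dot (penalty x y) (charVec z) <ℚ 0ℚ
    below z (tour , _) z≢x z≢y with all? (λ u → (z u ≟ x u) ⊎-dec (z u ≟ y u))
    ... | yes sub = [ (λ eq → contradiction (≗⇒SameVec eq) z≢x)
                    , (λ eq → contradiction (≗⇒SameVec eq) z≢y) ]′ (rigid z tour sub)
    ... | no ¬sub with ¬∀⟶∃¬ _ _ (λ u → (z u ≟ x u) ⊎-dec (z u ≟ y u)) ¬sub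
    ...   | u , off = dot-penalty-neg x y z u (tour-no-fixpoint tour u) (off ∘ inj₁) (off ∘ inj₂)

  Adjacent-respˡ : {x x′ y : Succ n} → IsPSB x′ → SameVec x x′ → Adjacent x y → Adjacent x′ y
  Adjacent-respˡ psb′ same (_ , psby , ne , c , eq , max) =
    psb′ , psby , (λ s → ne λ u v → trans (same u v) (s u v)) , c ,
    trans (sym dots) eq ,
    λ z psbz z≢x′ z≢y → subst (dot c (charVec z) <ℚ_) dots
      (max z psbz (λ s → z≢x′ λ u v → trans (s u v) (same u v)) z≢y)
    where
    dots = dot-cong c same

  PathLen-respˡ : ∀ {k} {x x′ y : Succ n} → IsPSB x′ → SameVec x x′ → PathLen k x y → PathLen k x′ y
  PathLen-respˡ psb′ same (here s)     = here λ u v → trans (sym (same u v)) (s u v)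
  PathLen-respˡ psb′ same (step adj p) = step (Adjacent-respˡ psb′ same adj) p

  PathLen-suc : ∀ {k} {x y : Succ n} → PathLen k x y → PathLen (suc k) x y
  PathLen-suc (here s)     = here s
  PathLen-suc (step adj p) = step adj (PathLen-suc p)

  -- A rigid pair may consist of the same vertex twice. Then there is no edge to take, and the bound
  -- on the length is relaxed instead.
  rigid-step : ∀ {k} {x y z : Succ n} → IsPSB x → IsPSB y → Rigid x y →
               PathLen k y z → PathLen (suc k) x z
  rigid-step {x = x} {y} psbx psby rigid path with all? (λ u → x u ≟ y u)
  ... | yes eq = PathLen-suc (PathLen-respˡ psbx (≗⇒SameVec (sym ∘ eq)) path)
  ... | no  ne = step (rigid⇒adjacent psbx psby (ne ∘ SameVec⇒≗) rigid) path

  Rigid-sym : {x y : Succ n} → Rigid x y → Rigid y x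
  Rigid-sym rigid z tour sub = swap (rigid z tour (swap ∘ sub))

  -- Tours whose only peak is the last city.

  -- `p` stands for the predecessor function. The positive form is symmetric in `x` and `p`, so
  -- reversing a tour is a mere swap.
  OnlyLastPeak : Succ n → Succ n → Set
  OnlyLastPeak x p = ∀ i → toℕ i ≢ suc (suc m) → i < x i ⊎ i < p i

  ≢last⇒< : ∀ {i : Fin n} → toℕ i ≢ suc (suc m) → toℕ i ℕ.< suc (suc m)
  ≢last⇒< {i} ne = ℕ.≤∧≢⇒< (toℕ≤pred[n] i) ne

  <⇒≢last : ∀ {i j : Fin n} → i < j → toℕ i ≢ suc (suc m)
  <⇒≢last {i} {j} lt eq = ℕ.<⇒≱ lt (subst (toℕ j ≤_) (sym eq) (toℕ≤pred[n] j))

  onlyLastPeak⇒PSB : {x p : Succ n} → IsTour x → Inverse x p → OnlyLastPeak x p → IsPSB x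
  onlyLastPeak⇒PSB {x} {p} tour (xp , px) hill = tour , λ i → only i , last i
    where
    only : ∀ i → ProperPeak x i → toℕ i ≡ suc (suc m)
    only i (((q , refl , q<i) , xi<i) , _) with toℕ i ℕ.≟ suc (suc m)
    ... | yes eq = eq
    ... | no  ne with hill i ne
    ...   | inj₁ lt = contradiction xi<i (ℕ.<-asym lt)
    ...   | inj₂ lt = contradiction q<i (ℕ.<-asym (subst (i <_) (px q) lt))
    below : ∀ i → toℕ i ≡ suc (suc m) → ∀ j → j ≢ i → j < i
    below i eq j ne = ℕ.≤∧≢⇒< (subst (toℕ j ≤_) (sym eq) (toℕ≤pred[n] j)) (ne ∘ toℕ-injective)
    last : ∀ i → toℕ i ≡ suc (suc m) → ProperPeak x i
    last i eq =
      ((p i , xp i , below i eq (p i) λ e → tour-no-fixpoint tour i (trans (cong x (sym e)) (xp i)))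
        , below i eq (x i) (tour-no-fixpoint tour i)) ,
      -- A step-back peak has a larger city two arcs away, which the last city cannot have.
      λ { (inj₁ (_ , _ , lt)) → <⇒≢last lt eq
        ; (inj₂ ((_ , _ , lt) , _)) → <⇒≢last lt eq }

  -- The cyclic shift.

  shift : Succ n
  shift i with toℕ i ℕ.≟ suc (suc m)
  ... | yes _ = fzero
  ... | no ne = fsuc (fromℕ< (≢last⇒< ne))

  shift-last : ∀ {i} → toℕ i ≡ suc (suc m) → shift i ≡ fzero
  shift-last {i} eq with toℕ i ℕ.≟ suc (suc m)
  ... | yes _ = refl
  ... | no ne = contradiction eq ne

  shift-suc : ∀ {i} → toℕ i ≢ suc (suc m) → toℕ (shift i) ≡ suc (toℕ i)
  shift-suc {i} ne with toℕ i ℕ.≟ suc (suc m)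
  ... | yes eq = contradiction eq ne
  ... | no ne′ = cong suc (toℕ-fromℕ< (≢last⇒< ne′))

  iter-shift : ∀ k i → k + toℕ i ≤ suc (suc m) → toℕ (iter shift k i) ≡ k + toℕ i
  iter-shift zero    i le = refl
  iter-shift (suc k) i le =
    trans (shift-suc λ eq → ℕ.<⇒≢ le (trans (sym ih) eq)) (cong suc ih)
    where
    ih : toℕ (iter shift k i) ≡ k + toℕ i
    ih = iter-shift k i (ℕ.<⇒≤ le)

  shift-injective : Injective _≡_ _≡_ shift
  shift-injective {i} {j} eq with toℕ i ℕ.≟ suc (suc m) | toℕ j ℕ.≟ suc (suc m)
  ... | yes a | yes b = toℕ-injective (trans a (sym b))
  ... | no a  | no b  = toℕ-injective (trans (sym (toℕ-fromℕ< (≢last⇒< a)))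
                          (trans (ℕ.suc-injective (cong toℕ eq)) (toℕ-fromℕ< (≢last⇒< b))))
  shift-injective () | yes _ | no _
  shift-injective () | no _  | yes _

  shift-tour : IsTour shift
  -- From `i` climb to the last city, take one more arc to the first city, then climb `toℕ j` steps.
  shift-tour = shift-injective , λ i j → toℕ j + suc (suc (suc m) ℕ.∸ toℕ i) ,
    toℕ-injective (trans (cong toℕ (trans (iter-+ shift (toℕ j) _ i) (cong (iter shift (toℕ j)) (toZero i))))
      (trans (iter-shift (toℕ j) fzero (subst (_≤ suc (suc m)) (sym (ℕ.+-identityʳ (toℕ j))) (toℕ≤pred[n] j)))
        (ℕ.+-identityʳ (toℕ j))))
    where
    toZero : ∀ i → iter shift (suc (suc (suc m) ℕ.∸ toℕ i)) i ≡ fzero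
    toZero i = shift-last (trans (iter-shift (suc (suc m) ℕ.∸ toℕ i) i (ℕ.≤-reflexive reach)) reach)
      where
      reach : suc (suc m) ℕ.∸ toℕ i + toℕ i ≡ suc (suc m)
      reach = ℕ.m∸n+n≡m (toℕ≤pred[n] i)

  shift-PSB : IsPSB shift
  shift-PSB with tour-inverse shift-tour
  ... | p , inv = onlyLastPeak⇒PSB shift-tour inv λ i ne → inj₁ (ℕ.≤-reflexive (sym (shift-suc ne)))

  swap-onlyLastPeak : ∀ {x p} → OnlyLastPeak x p → OnlyLastPeak p x
  swap-onlyLastPeak hill i ne = swap (hill i ne)

  -- Rigidity of a single-peak tour with the shift.

  -- The predecessor `i` of `x i` is smaller, so the larger neighbour of `x i` must be its
  -- successor.
  ascent-next : ∀ {x p} → Inverse x p → OnlyLastPeak x p →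
                ∀ {i} → i < x i → toℕ (x i) ≢ suc (suc m) → x i < x (x i)
  ascent-next {x} (_ , px) hill {i} lt ne with hill (x i) ne
  ... | inj₁ up   = up
  ... | inj₂ down = contradiction (subst (x i <_) (px i) down) (ℕ.<-asym lt)

  -- The ascending arcs form a single increasing chain, so none of them jumps over the tail of another.
  ascents-nest-free : ∀ {x p} → Inverse x p → OnlyLastPeak x p →
                      ∀ {u i} → u < i → i < x u → ¬ i < x i
  ascents-nest-free {x} {p} inv hill {u} {i} = go (n + n) (ℕ.m≤m+n (n + n) (toℕ u + toℕ i))
    where
    inj : ∀ {a b} → x a ≡ x b → a ≡ b
    inj {a} {b} eq = trans (sym (proj₂ inv a)) (trans (cong p eq) (proj₂ inv b))

    -- Of two overlapping ascents, advance the one that ends lower: the ascent it continues with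
    -- overlaps the other one again. The sum of the two tails grows but stays below `n + n`, so `k`
    -- bounds the remaining rounds.
    go : ∀ k {u i} → n + n ≤ k + (toℕ u + toℕ i) → u < i → i < x u → ¬ i < x i
    go zero {u} {i} le _ _ _ = ℕ.<⇒≱ (ℕ.+-mono-< (toℕ<n u) (toℕ<n i)) le
    go (suc k) {u} {i} le u<i i<xu i<xi with <-cmp (x i) (x u)
    ... | tri< lt _ _ = go k {u} {x i}
          (ℕ.≤-trans le (subst (_≤ k + (toℕ u + toℕ (x i))) (ℕ.+-suc k _) (ℕ.+-monoʳ-≤ k
            (subst (_≤ toℕ u + toℕ (x i)) (ℕ.+-suc (toℕ u) (toℕ i)) (ℕ.+-monoʳ-≤ (toℕ u) i<xi)))))
          (ℕ.<-trans u<i i<xi) lt (ascent-next inv hill i<xi (<⇒≢last lt))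
    ... | tri≈ _ eq _ = ℕ.<⇒≢ u<i (cong toℕ (sym (inj eq)))
    ... | tri> _ _ gt = go k {i} {x u}
          (ℕ.≤-trans le (subst (_≤ k + (toℕ i + toℕ (x u))) (ℕ.+-suc k _) (ℕ.+-monoʳ-≤ k
            (subst (_≤ toℕ i + toℕ (x u)) (cong suc (ℕ.+-comm (toℕ i) (toℕ u)))
              (subst (_≤ toℕ i + toℕ (x u)) (ℕ.+-suc (toℕ i) (toℕ u))
                (ℕ.+-monoʳ-≤ (toℕ i) (ℕ.<-trans u<i i<xu)))))))
          i<xu gt (ascent-next inv hill (ℕ.<-trans u<i i<xu) (<⇒≢last gt))

  -- The choice of `z` at the last city decides everything: the arc to the first city forces the
  -- shift, the arc of `x` forces `x`.
  onlyLastPeak⇒rigid-shift : ∀ {x p} → IsTour x → Inverse x p → OnlyLastPeak x p → Rigid x shift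
  onlyLastPeak⇒rigid-shift {x} {p} tour inv@(xp , px) hill z tourz@(injz , _) sub =
    [ (λ eq → inj₁ (follow-x eq)) , (λ eq → inj₂ (follow-shift (trans eq (shift-last last-top)))) ]′ (sub last)
    where
    last : Fin n
    last = fromℕ (suc (suc m))

    last-top : toℕ last ≡ suc (suc m)
    last-top = toℕ-fromℕ (suc (suc m))

    is-last : ∀ {i} → toℕ i ≡ suc (suc m) → i ≡ last
    is-last eq = toℕ-injective (trans eq (sym last-top))

    <-shift : ∀ {i} → toℕ i ≢ suc (suc m) → i < shift i
    <-shift ne = ℕ.≤-reflexive (sym (shift-suc ne))

    shift≤ : ∀ {i j} → i < j → toℕ (shift i) ≤ toℕ j
    shift≤ {i} {j} lt = subst (_≤ toℕ j) (sym (shift-suc (<⇒≢last lt))) lt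

    last? : ∀ i → i ≡ last ⊎ toℕ i ≢ suc (suc m)
    last? i with toℕ i ℕ.≟ suc (suc m)
    ... | yes eq = inj₁ (is-last eq)
    ... | no  ne = inj₂ ne

    -- If z leaves the shift at u, it jumps over a nonempty interval from which it cannot escape.
    follow-shift : z last ≡ fzero → z ≗ shift
    follow-shift zlast i with last? i
    ... | inj₁ refl = trans zlast (sym (shift-last last-top))
    ... | inj₂ i≢last = <-rec Agrees agree (toℕ i) i refl i≢last
      where
      Agrees : ℕ → Set
      Agrees k = ∀ u → toℕ u ≡ k → toℕ u ≢ suc (suc m) → z u ≡ shift u

      agree : ∀ k → (∀ {l} → l ℕ.< k → Agrees l) → Agrees k
      agree _ ih u refl ne with sub u
      ... | inj₂ eq = eq
      ... | inj₁ eq = compare (ℕ.<-cmp (suc (toℕ u)) (toℕ (x u)))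
        where
        -- By induction every city up to `u` is already entered in `z`, the first from the last city
        -- and the others from below `u`. By injectivity the remaining cities are sent beyond `u`.
        hit : ∀ v → toℕ v ≤ toℕ u → ∃ λ w → z w ≡ v × (w ≡ last ⊎ w < u)
        hit fzero    _  = last , zlast , inj₁ refl
        hit (fsuc v) lt = w , trans (ih w<u w refl w≢last) shift-w , inj₂ w<u
          where
          w : Fin n
          w = inject₁ v
          w<u : w < u
          w<u = subst (ℕ._< toℕ u) (sym (toℕ-inject₁ v)) lt
          w≢last : toℕ w ≢ suc (suc m)
          w≢last = <⇒≢last w<u
          shift-w : shift w ≡ fsuc v
          shift-w = toℕ-injective (trans (shift-suc w≢last) (cong suc (toℕ-inject₁ v)))

        beyond : ∀ i → toℕ i ≢ suc (suc m) → toℕ u ≤ toℕ i → u < z i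
        beyond i i≢last u≤i with ℕ.<-≤-connex (toℕ u) (toℕ (z i))
        ... | inj₁ lt = lt
        ... | inj₂ ge with hit (z i) ge
        ...   | w , zw≡zi , from with injz zw≡zi | from
        ...     | refl | inj₁ refl = contradiction last-top i≢last
        ...     | refl | inj₂ i<u  = contradiction u≤i (ℕ.<⇒≱ i<u)

        module _ (jump : suc (toℕ u) ℕ.< toℕ (x u)) where
          Inside : Fin n → Set
          Inside i = u < i × i < x u

          closed : ∀ i → Inside i → Inside (z i)
          closed i (u<i , i<xu) = beyond i (<⇒≢last i<xu) (ℕ.<⇒≤ u<i) , below (sub i)
            where
            -- No ascent of `x` starts inside the interval. A shift arc could leave only by ending
            -- at `x u`, which `z` already enters from `u`.
            below : z i ≡ x i ⊎ z i ≡ shift i → z i < x u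
            below (inj₁ e) = subst (_< x u) (sym e)
              (ℕ.≤-<-trans (ℕ.≮⇒≥ (ascents-nest-free inv hill u<i i<xu)) i<xu)
            below (inj₂ e) = ℕ.≤∧≢⇒< (subst (λ v → toℕ v ≤ toℕ (x u)) (sym e) (shift≤ i<xu))
              λ same → ℕ.<⇒≢ u<i (cong toℕ (injz (trans eq (sym (toℕ-injective same)))))

          trapped : ⊥
          trapped = ℕ.n≮0 (proj₁ (closed⇒all tourz Inside closed (shift u)
            (<-shift ne , subst (ℕ._< toℕ (x u)) (sym (shift-suc ne)) jump) fzero))

        compare : _ → z u ≡ shift u
        compare (tri< lt _ _) = ⊥-elim (trapped lt)
        compare (tri≈ _ e _)  = trans eq (toℕ-injective (trans (sym e) (sym (shift-suc ne))))
        compare (tri> _ _ gt) =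
          contradiction (s≤s⁻¹ gt) (ℕ.<⇒≱ (subst (u <_) eq (beyond u ne ℕ.≤-refl)))

    module _ (zlast : z last ≡ x last) where

      -- If z leaves x at a descending arc from a, then no city below a is reached from a.
      descending : ∀ {a} → x a < a → z a ≡ x a
      -- Induction from the last city downwards, hence the measure `n ∸ toℕ a`.
      descending {a} xa<a = <-rec Agrees agree (n ℕ.∸ toℕ a) a refl xa<a
        where
        Agrees : ℕ → Set
        Agrees k = ∀ a → n ℕ.∸ toℕ a ≡ k → x a < a → z a ≡ x a

        agree : ∀ k → (∀ {l} → l ℕ.< k → Agrees l) → Agrees k
        agree _ ih a refl xa<a with last? a | sub a
        ... | inj₁ refl | _ = zlast
        ... | inj₂ _ | inj₁ eq = eq
        ... | inj₂ ne | inj₂ eq = ⊥-elim (ℕ.n≮0 (ℕ.<-≤-trans xa<a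
                (closed⇒all tourz (λ v → toℕ a ≤ toℕ v) closed a ℕ.≤-refl fzero)))
          where
          a<pa : a < p a
          a<pa with hill a ne
          ... | inj₁ lt = contradiction xa<a (ℕ.<-asym lt)
          ... | inj₂ lt = lt

          closed : ∀ v → toℕ a ≤ toℕ v → toℕ a ≤ toℕ (z v)
          closed v a≤v with <-cmp (x v) v
          ... | tri≈ _ e _ = contradiction e (tour-no-fixpoint tour v)
          ... | tri> _ _ v<xv with sub v
          ...   | inj₁ e = subst (λ w → toℕ a ≤ toℕ w) (sym e) (ℕ.≤-trans a≤v (ℕ.<⇒≤ v<xv))
          ...   | inj₂ e = subst (λ w → toℕ a ≤ toℕ w) (sym e)
                  (ℕ.≤-trans a≤v (ℕ.<⇒≤ (<-shift (<⇒≢last v<xv))))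
          closed v a≤v | tri< xv<v _ _ with <-cmp a v
          ... | tri≈ _ refl _ = subst (λ w → toℕ a ≤ toℕ w) (sym eq) (ℕ.<⇒≤ (<-shift ne))
          ... | tri> _ _ v<a = contradiction a≤v (ℕ.<⇒≱ v<a)
          -- Read backwards, descents of `x` are ascents of `p`. If `x v` were below `a`, the ascent
          -- from `x v` to `v` would jump over the tail of the ascent from `a` to `p a`.
          ... | tri< a<v _ _ = subst (λ w → toℕ a ≤ toℕ w)
                (sym (ih (ℕ.∸-monoʳ-< a<v (ℕ.<⇒≤ (toℕ<n v))) v refl xv<v))
                (ℕ.≮⇒≥ λ xv<a → ascents-nest-free (Inverse-sym {x = x} inv) (swap-onlyLastPeak hill)
                  xv<a (subst (a <_) (sym (px v)) a<v) a<pa)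

      follow-x : z ≗ x
      follow-x u with <-cmp (x u) u | sub u
      ... | tri< lt _ _ | _       = descending lt
      ... | tri≈ _ e _  | _       = contradiction e (tour-no-fixpoint tour u)
      ... | tri> _ _ _  | inj₁ eq = eq
      ... | tri> _ _ u<xu | inj₂ eq with ℕ.<-cmp (toℕ (shift u)) (toℕ (x u))
      ...   | tri≈ _ e _ = trans eq (toℕ-injective e)
      ...   | tri> _ _ gt = contradiction (shift≤ u<xu) (ℕ.<⇒≱ gt)
      ...   | tri< lt _ _ with hill (shift u) (<⇒≢last lt)
      ...     | inj₁ up = contradiction up (ascents-nest-free inv hill (<-shift (<⇒≢last u<xu)) lt)
      -- `z` would enter `shift u` twice: from `u`, and by the descent of `x` from the larger city
      -- `p (shift u)`, which `z` follows.
      ...     | inj₂ s<ps = contradiction (cong toℕ u≡ps) (ℕ.<⇒≢ (ℕ.<-trans (<-shift (<⇒≢last u<xu)) s<ps))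
        where
        u≡ps : u ≡ p (shift u)
        u≡ps = injz (trans eq (sym (trans (descending (subst (_< p (shift u)) (sym (xp (shift u))) s<ps)) (xp (shift u)))))

  -- Step-back peaks and the pairs they exchange.

  stepBackPeak? : ∀ (x : Succ n) i → Dec (StepBackPeak x i)
  stepBackPeak? x i =
    (any? (λ p → (x p ≟ i) ×-dec (p <? i)) ×-dec (suc (toℕ (x i)) ℕ.≟ toℕ i) ×-dec (i <? x (x i)))
    ⊎-dec
    (any? (λ q → (x (x q) ≟ i) ×-dec (i <? q)) ×-dec
     any? (λ p → (x p ≟ i) ×-dec (suc (toℕ p) ℕ.≟ toℕ i)) ×-dec (x i <? i))

  -- The first kind of step-back peak. The second kind is this one in the reversed tour,
  -- `StepBack p x`.
  StepBack : Succ n → Succ n → Fin n → Set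
  StepBack x p i = p i < i × suc (toℕ (x i)) ≡ toℕ i × i < x (x i)

  stepBackPeak⇒ : ∀ {x p} → Inverse x p → ∀ {i} → StepBackPeak x i → StepBack x p i ⊎ StepBack p x i
  stepBackPeak⇒ (_ , px) (inj₁ ((q , refl , q<i) , back , up)) =
    inj₁ (subst (_< _) (sym (px q)) q<i , back , up)
  stepBackPeak⇒ {x} {p} (_ , px) (inj₂ ((q , refl , i<q) , (r , xr≡i , back) , down)) =
    inj₂ (down , trans (cong (suc ∘ toℕ) p≡r) back , subst (_ <_) (sym (trans (cong p (px (x q))) (px q))) i<q)
    where
    p≡r : p (x (x q)) ≡ r
    p≡r = trans (cong p (sym xr≡i)) (px r)

  -- The tour would run from `j` to `i` and on to `i` - 1, while a step-back from `j` must continue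
  -- above `j`.
  stepBack-disjoint-same : ∀ {x p i j} → StepBack x p i → StepBack x p j → suc (toℕ i) ≢ toℕ j
  stepBack-disjoint-same {x} (_ , backi , _) (_ , backj , upj) adj
    with toℕ-injective (ℕ.suc-injective (trans backj (sym adj)))
  ... | refl = ℕ.<-asym (ℕ.<-trans (ℕ.≤-reflexive backi) (ℕ.≤-reflexive adj)) upj

  -- The tour would leave `i` both for `i` - 1 and for `j`.
  stepBack-disjoint-opposite : ∀ {x p} → Inverse x p → ∀ {i j} →
                               StepBack x p i → StepBack p x j → suc (toℕ i) ≢ toℕ j
  stepBack-disjoint-opposite {x} (xp , _) {i} {j} (_ , backi , _) (_ , backj , _) adj =
    ℕ.<-asym (ℕ.≤-reflexive adj) (ℕ.≤-reflexive (trans (cong (suc ∘ toℕ) (sym xi≡j)) backi))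
    where
    xi≡j : x i ≡ j
    xi≡j = trans (cong x (sym (toℕ-injective (ℕ.suc-injective (trans backj (sym adj)))))) (xp j)

  -- Hence the pairs formed by a step-back peak and the city just below it are disjoint and can all
  -- be exchanged at once.
  stepBackPeak-disjoint : ∀ {x p} → Inverse x p → ∀ {i j} →
                          StepBackPeak x i → StepBackPeak x j → suc (toℕ i) ≢ toℕ j
  stepBackPeak-disjoint {x} {p} inv bi bj with stepBackPeak⇒ inv bi | stepBackPeak⇒ inv bj
  ... | inj₁ a | inj₁ b = stepBack-disjoint-same {x} {p} a b
  ... | inj₁ a | inj₂ b = stepBack-disjoint-opposite {x} {p} inv a b
  ... | inj₂ a | inj₁ b = stepBack-disjoint-opposite {p} {x} (Inverse-sym {x = x} inv) a b
  ... | inj₂ a | inj₂ b = stepBack-disjoint-same {p} {x} a b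

  -- The graph of the involution `θ`. Being an involution then amounts to symmetry and uniqueness,
  -- and `alone` records why the two other cases are excluded.
  data Partner (x : Succ n) (i j : Fin n) : Set where
    upper : StepBackPeak x i → suc (toℕ j) ≡ toℕ i → Partner x i j
    lower : StepBackPeak x j → suc (toℕ i) ≡ toℕ j → Partner x i j
    alone : ¬ StepBackPeak x i → (∀ k → suc (toℕ i) ≡ toℕ k → ¬ StepBackPeak x k) →
            i ≡ j → Partner x i j

  Partner-sym : ∀ {x i j} → Partner x i j → Partner x j i
  Partner-sym (upper b eq)      = lower b eq
  Partner-sym (lower b eq)      = upper b eq
  Partner-sym (alone a b refl)  = alone a b refl

  Partner-unique : ∀ {x p} → Inverse x p → ∀ {i j k} → Partner x i j → Partner x i k → j ≡ k
  Partner-unique inv (upper _ e) (upper _ e′) = toℕ-injective (ℕ.suc-injective (trans e (sym e′)))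
  Partner-unique inv (upper b _) (lower b′ e′) = contradiction e′ (stepBackPeak-disjoint inv b b′)
  Partner-unique inv (upper b _) (alone ¬b _ _) = contradiction b ¬b
  Partner-unique inv (lower b e) (upper b′ _) = contradiction e (stepBackPeak-disjoint inv b′ b)
  Partner-unique inv (lower _ e) (lower _ e′) = toℕ-injective (trans (sym e) e′)
  Partner-unique inv (lower b e) (alone _ ¬b _) = contradiction b (¬b _ e)
  Partner-unique inv (alone ¬b _ _) (upper b _) = contradiction b ¬b
  Partner-unique inv (alone _ ¬b _) (lower b e) = contradiction b (¬b _ e)
  Partner-unique inv (alone _ _ refl) (alone _ _ refl) = refl

  partner : ∀ x i → ∃ (Partner x i)
  partner x i with stepBackPeak? x i
  partner x (fsuc i) | yes b = inject₁ i , upper b (cong suc (toℕ-inject₁ i))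
  partner x fzero | yes (inj₁ (_ , () , _))
  partner x fzero | yes (inj₂ (_ , (_ , _ , ()) , _))
  ... | no ¬b with any? (λ j → (suc (toℕ i) ℕ.≟ toℕ j) ×-dec stepBackPeak? x j)
  ...   | yes (j , e , b) = j , lower b e
  ...   | no ¬above       = i , alone ¬b (λ k e b → ¬above (k , e , b)) refl

  -- Rigidity of a tour with its flipped reversal.

  -- All that `follow` needs to know about `θ`: it moves each city by at most one position along the
  -- tour.
  Flips : Succ n → Succ n → Succ n → Set
  Flips x p θ = (∀ i → θ (θ i) ≡ i) × θ fzero ≡ fzero × (∀ i → θ i ≡ i ⊎ θ i ≡ x i ⊎ θ i ≡ p i)

  -- Follow x from its first city: as long as z agrees with x, any deviation of z into θ x⁻¹ θ
  -- leads back to a city that is already visited.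
  follow : ∀ {x p θ z} → IsTour x → Inverse x p → Flips x p θ → IsTour z →
           z ⊆ x ∪ (θ ∘ p ∘ θ) → z fzero ≡ x fzero → z ≗ x
  follow {x} {p} {θ} {z} tour@(_ , reach) (xp , px) (θθ , θ0 , near) tourz@(injz , _) sub start i
    with reach fzero i
  ... | k , refl = <-rec Agrees agree k
    where
    at : ℕ → Fin n
    at k = iter x k fzero

    Agrees : ℕ → Set
    Agrees k = z (at k) ≡ at (suc k)

    θ-visited : ∀ k → ∃ λ j → j ≤ suc k × θ (at k) ≡ at j
    θ-visited k with near (at k)
    ... | inj₁ e        = k , ℕ.n≤1+n k , e
    ... | inj₂ (inj₁ e) = suc k , ℕ.≤-refl , e
    θ-visited zero    | inj₂ (inj₂ e) = zero , z≤n , θ0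
    θ-visited (suc k) | inj₂ (inj₂ e) = k , ℕ.m≤n+m k 2 , trans e (px (at k))

    -- If `θ` moves `at (suc k)` forward, the deviating arc is the arc of `x` itself. If `θ` fixes
    -- it or moves it back, `p` leads to an earlier position, and the outer `θ` gains at most one.
    deviation : ∀ k → θ (p (θ (at (suc k)))) ≡ at (suc (suc k)) ⊎
                      ∃ λ j → j ≤ suc k × θ (p (θ (at (suc k)))) ≡ at j
    deviation k with near (at (suc k))
    ... | inj₁ e = inj₂ (proj₁ v , proj₁ (proj₂ v) ,
            trans (cong θ (trans (cong p e) (px (at k)))) (proj₂ (proj₂ v)))
      where v = θ-visited k
    ... | inj₂ (inj₁ e) = inj₁ (trans (cong θ (trans (cong p e) (px (at (suc k))))) e)
    deviation zero    | inj₂ (inj₂ e) = contradiction at1≡0 (tour-no-fixpoint tour fzero)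
      where
      at1≡0 : x fzero ≡ fzero
      at1≡0 = trans (sym (θθ (x fzero))) (trans (cong θ (trans e (px fzero))) θ0)
    deviation (suc k) | inj₂ (inj₂ e) = inj₂ (proj₁ v , ℕ.≤-trans (proj₁ (proj₂ v)) (ℕ.n≤1+n (suc k)) ,
            trans (cong θ (trans (cong p (trans e (px (at (suc k))))) (px (at k)))) (proj₂ (proj₂ v)))
      where v = θ-visited k

    agree : ∀ k → (∀ {l} → l ℕ.< k → Agrees l) → Agrees k
    agree zero    _  = start
    agree (suc k) ih with sub (at (suc k))
    ... | inj₁ e = e
    ... | inj₂ e with deviation k
    ...   | inj₁ d = trans e d
    -- `z` already enters `at (suc j)` from `at j`, so injectivity identifies `at (suc k)` with
    -- `at j`, where `z` follows `x`.
    ...   | inj₂ (suc j , j<k , d) = trans (cong z same) (trans (ih j<k) (cong x (sym same)))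
      where
      same : at (suc k) ≡ at j
      same = injz (trans e (trans d (sym (ih j<k))))
    -- `z` closes up at the first city, so the visited cities are all cities and `at (suc (suc k))`
    -- is one of them. Either it is the first city, or `at (suc k)` repeats an earlier position.
    ...   | inj₂ (zero , _ , d) = conclude (closed⇒all tourz Visited closed fzero (zero , z≤n , refl) (at (suc (suc k))))
      where
      closing : z (at (suc k)) ≡ fzero
      closing = trans e d

      Visited : Fin n → Set
      Visited v = ∃ λ j → j ≤ suc k × at j ≡ v

      closed : ∀ v → Visited v → Visited (z v)
      closed _ (j , j≤ , refl) with ℕ.m≤n⇒m<n∨m≡n j≤
      ... | inj₁ j<  = suc j , j< , sym (ih j<)
      ... | inj₂ refl = zero , z≤n , sym closing

      conclude : Visited (at (suc (suc k))) → z (at (suc k)) ≡ at (suc (suc k))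
      conclude (zero  , _ , at≡) = trans closing at≡
      conclude (suc j , j<k , at≡) = trans (cong z same) (trans (ih j<k) at≡)
        where
        same : at (suc k) ≡ at j
        same = trans (sym (px (at (suc k)))) (trans (cong p (sym at≡)) (px (at j)))

  Inverse-conjugate : ∀ {x p θ : Succ n} → (∀ i → θ (θ i) ≡ i) → Inverse x p →
                      Inverse (θ ∘ p ∘ θ) (θ ∘ x ∘ θ)
  Inverse-conjugate {x} {p} {θ} θθ (xp , px) = cancel p x px , cancel x p xp
    where
    cancel : ∀ f g → (∀ i → f (g i) ≡ i) → ∀ i → θ (f (θ (θ (g (θ i))))) ≡ i
    cancel f g fg i = trans (cong (θ ∘ f) (θθ (g (θ i)))) (trans (cong θ (fg (θ i))) (θθ i))

  tour-conjugate : ∀ {x θ : Succ n} → (∀ i → θ (θ i) ≡ i) → IsTour x → IsTour (θ ∘ x ∘ θ)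
  tour-conjugate {x} {θ} θθ (inj , reach) =
    (λ eq → θ-inj (inj (θ-inj eq))) ,
    λ i j → proj₁ (reach (θ i) (θ j)) ,
      trans (iter-conjugate (proj₁ (reach (θ i) (θ j))) i)
        (trans (cong θ (proj₂ (reach (θ i) (θ j)))) (θθ j))
    where
    θ-inj : ∀ {i j} → θ i ≡ θ j → i ≡ j
    θ-inj {i} {j} eq = trans (sym (θθ i)) (trans (cong θ eq) (θθ j))
    iter-conjugate : ∀ k i → iter (θ ∘ x ∘ θ) k i ≡ θ (iter x k (θ i))
    iter-conjugate zero    i = sym (θθ i)
    iter-conjugate (suc k) i = cong (θ ∘ x) (trans (cong θ (iter-conjugate k i)) (θθ _))

  Flips-conjugate : ∀ {x p θ} → Inverse x p → Flips x p θ → Flips (θ ∘ p ∘ θ) (θ ∘ x ∘ θ) θ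
  Flips-conjugate {x} {p} {θ} (xp , px) (θθ , θ0 , near) = θθ , θ0 , λ i → near′ i (near i)
    where
    near′ : ∀ i → θ i ≡ i ⊎ θ i ≡ x i ⊎ θ i ≡ p i →
            θ i ≡ i ⊎ θ i ≡ θ (p (θ i)) ⊎ θ i ≡ θ (x (θ i))
    near′ i (inj₁ e)        = inj₁ e
    near′ i (inj₂ (inj₁ e)) = inj₂ (inj₁ (cong θ (sym (trans (cong p e) (px i)))))
    near′ i (inj₂ (inj₂ e)) = inj₂ (inj₂ (cong θ (sym (trans (cong x e) (xp i)))))

  -- The arc of `z` at the first city selects the tour to follow. Both cases are `follow`, because
  -- inverting and conjugating once more gives `x` back.
  rigid-conjugate-inverse : ∀ {x p θ} → IsTour x → Inverse x p → Flips x p θ → Rigid x (θ ∘ p ∘ θ)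
  rigid-conjugate-inverse {x} {p} {θ} tour inv flips@(θθ , _) z tourz sub =
    [ (λ start → inj₁ (follow tour inv flips tourz sub start))
    , (λ start → inj₂ (follow (tour-conjugate {θ = θ} θθ (inverse-tour inv tour)) (Inverse-conjugate {x} {p} {θ} θθ inv)
                              (Flips-conjugate {x} {p} {θ} inv flips) tourz sub′ start)) ]′ (sub fzero)
    where
    sub′ : z ⊆ (θ ∘ p ∘ θ) ∪ (θ ∘ (θ ∘ x ∘ θ) ∘ θ)
    sub′ u = [ (λ e → inj₂ (trans e (sym (trans (θθ _) (cong x (θθ u)))))) , inj₁ ]′ (sub u)

  -- Straightening the step-backs.

  Straightening : Succ n → Set
  Straightening x = ∃ λ y → IsPSB y × Rigid x y × Rigid y shift

  module _ {x p flip : Succ n} (psb : IsPSB x) (inv : Inverse x p)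
           (flip-partner : ∀ i → Partner x i (flip i)) where

    private
      tour = proj₁ psb
      xp = proj₁ inv
      px = proj₂ inv

    -- `flip` lowers a city by at most one, so the order can fail only if `k` is lowered to `i`,
    -- that is, if the two are exchanged.
    flip-lift : ∀ {i k} → i < k → flip i ≢ k → i < flip k
    flip-lift {i} {k} i<k ne with flip k | flip-partner k
    ... | _ | alone _ _ refl = i<k
    ... | _ | lower _ e      = ℕ.<-trans i<k (ℕ.≤-reflexive e)
    ... | j | par@(upper _ e) = ℕ.≤∧≢⇒< (s≤s⁻¹ (subst (toℕ i ℕ.<_) (sym e) i<k))
            λ i≡j → ne (Partner-unique inv (flip-partner i)
              (subst (λ v → Partner x v k) (sym (toℕ-injective i≡j)) (Partner-sym par)))

    -- A step-back peak and the city just below it are joined by an arc of the tour, in one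
    -- direction or the other.
    flip-near : ∀ i → flip i ≡ i ⊎ flip i ≡ x i ⊎ flip i ≡ p i
    flip-near i with flip i | flip-partner i
    ... | j | alone _ _ refl = inj₁ refl
    ... | j | upper b e with stepBackPeak⇒ inv b
    ...   | inj₁ (_ , back , _) = inj₂ (inj₁ (toℕ-injective (ℕ.suc-injective (trans e (sym back)))))
    ...   | inj₂ (_ , back , _) = inj₂ (inj₂ (toℕ-injective (ℕ.suc-injective (trans e (sym back)))))
    flip-near i | j | lower b e with stepBackPeak⇒ inv b
    ...   | inj₁ (_ , back , _) = inj₂ (inj₂ (trans (sym (px j))
              (cong p (toℕ-injective (ℕ.suc-injective (trans back (sym e)))))))
    ...   | inj₂ (_ , back , _) = inj₂ (inj₁ (trans (sym (xp j))
              (cong x (toℕ-injective (ℕ.suc-injective (trans back (sym e)))))))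

    both-below-one : ∀ {j} → toℕ j ≡ 1 → x j < j → ¬ p j < j
    both-below-one {j} j≡1 xj<j pj<j = tour-no-2-cycle tour j
      (trans (cong x (trans (isZero xj<j) (sym (isZero pj<j)))) (xp j))
      where
      isZero : ∀ {v} → v < j → v ≡ fzero
      isZero lt = toℕ-injective (ℕ.n<1⇒n≡0 (subst (_ ℕ.<_) j≡1 lt))

    -- Otherwise the second city would be a step-back peak. Both its neighbours would then be the
    -- first city, a cycle of length two.
    flip-zero : flip fzero ≡ fzero
    flip-zero with flip fzero | flip-partner fzero
    ... | _ | alone _ _ eq = sym eq
    ... | j | lower b e with stepBackPeak⇒ inv b
    ...   | inj₁ (lt , back , _) = ⊥-elim (both-below-one (sym e) (ℕ.≤-reflexive back) lt)
    ...   | inj₂ (lt , back , _) = ⊥-elim (both-below-one (sym e) lt (ℕ.≤-reflexive back))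

    flip-involutive : ∀ i → flip (flip i) ≡ i
    flip-involutive i = Partner-unique inv (flip-partner (flip i)) (Partner-sym (flip-partner i))

    flip-flips : Flips x p flip
    flip-flips = flip-involutive , flip-zero , flip-near

    not-peak : ∀ i → toℕ i ≢ suc (suc m) → ¬ StepBackPeak x i → i < x i ⊎ i < p i
    not-peak i ne ¬b with <-cmp (x i) i | <-cmp (p i) i
    ... | tri> _ _ gt | _ = inj₁ gt
    ... | _ | tri> _ _ gt = inj₂ gt
    ... | tri≈ _ e _ | _ = contradiction e (tour-no-fixpoint tour i)
    ... | _ | tri≈ _ e _ = contradiction e (tour-no-fixpoint (inverse-tour inv tour) i)
    ... | tri< xi<i _ _ | tri< pi<i _ _ =
      contradiction (proj₁ (proj₂ psb i) (((p i , xp i , pi<i) , xi<i) , ¬b)) ne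

    -- Up to direction, a step-back a, i, i - 1, b with b above i turns into a climb: i - 1 now has
    -- the neighbour i, and i has the image of b. Any other city keeps a larger neighbour by
    -- `flip-lift`.
    straightened : OnlyLastPeak (flip ∘ p ∘ flip) (flip ∘ x ∘ flip)
    straightened i ne = through (flip-partner i) refl
      where
      lift-x : i < x (flip i) → i < flip (x (flip i))
      lift-x lt = flip-lift lt (tour-no-fixpoint tour (flip i) ∘ sym)

      lift-p : i < p (flip i) → i < flip (p (flip i))
      lift-p lt = flip-lift lt (tour-no-fixpoint (inverse-tour inv tour) (flip i) ∘ sym)

      back-to-i : ∀ {j v} → flip i ≡ j → suc (toℕ i) ≡ toℕ j → suc (toℕ v) ≡ toℕ j → i < flip v
      back-to-i refl e back = subst (λ v → i < flip v)
        (toℕ-injective (ℕ.suc-injective (trans e (sym back)))) (ℕ.≤-reflexive e)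

      through : ∀ {j} → Partner x i j → flip i ≡ j → i < flip (p (flip i)) ⊎ i < flip (x (flip i))
      through (alone ¬b _ refl) eq with not-peak i ne ¬b
      ... | inj₁ lt = inj₂ (lift-x (subst (λ j → i < x j) (sym eq) lt))
      ... | inj₂ lt = inj₁ (lift-p (subst (λ j → i < p j) (sym eq) lt))
      through (upper b e) eq with stepBackPeak⇒ inv b
      ... | inj₁ (_ , back , lt) = inj₂ (lift-x (subst (λ j → i < x j)
              (toℕ-injective (ℕ.suc-injective (trans back (trans (sym e) (cong (suc ∘ toℕ) (sym eq)))))) lt))
      ... | inj₂ (_ , back , lt) = inj₁ (lift-p (subst (λ j → i < p j)
              (toℕ-injective (ℕ.suc-injective (trans back (trans (sym e) (cong (suc ∘ toℕ) (sym eq)))))) lt))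
      through (lower b e) eq with stepBackPeak⇒ inv b
      ... | inj₁ (_ , back , _) = inj₂ (back-to-i eq e (trans (cong (suc ∘ toℕ ∘ x) eq) back))
      ... | inj₂ (_ , back , _) = inj₁ (back-to-i eq e (trans (cong (suc ∘ toℕ ∘ p) eq) back))

    straighten-along : Straightening x
    straighten-along = flip ∘ p ∘ flip
      , onlyLastPeak⇒PSB tour′ inv′ straightened
      , rigid-conjugate-inverse tour inv flip-flips
      , onlyLastPeak⇒rigid-shift tour′ inv′ straightened
      where
      tour′ : IsTour (flip ∘ p ∘ flip)
      tour′ = tour-conjugate {θ = flip} flip-involutive (inverse-tour inv tour)
      inv′ : Inverse (flip ∘ p ∘ flip) (flip ∘ x ∘ flip)
      inv′ = Inverse-conjugate {x} {p} {flip} flip-involutive inv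

  straighten : ∀ {x} → IsPSB x → Straightening x
  straighten {x} psb = straighten-along {flip = λ i → proj₁ (partner x i)} psb
    (proj₂ (tour-inverse (proj₁ psb))) (λ i → proj₂ (partner x i))

  -- Joining two paths at the shift.

  path-through-shift : ∀ {x y} → IsPSB x → IsPSB y → Straightening x → Straightening y → PathLen 4 x y
  path-through-shift psbx psby (x′ , psbx′ , x~x′ , x′~shift) (y′ , psby′ , y~y′ , y′~shift) =
    rigid-step psbx psbx′ x~x′
      (rigid-step psbx′ shift-PSB x′~shift
        (rigid-step shift-PSB psby′ (Rigid-sym y′~shift)
          (rigid-step psby′ psby (Rigid-sym y~y′) (here λ _ _ → refl))))

theorem3 : ∀ (n : ℕ) → 3 ≤ n → ∀ (τ σ : Succ n) → IsPSB τ → IsPSB σ → PathLen 4 τ σ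
theorem3 (suc (suc (suc m))) _ τ σ psbτ psbσ =
  path-through-shift psbτ psbσ (straighten psbτ) (straighten psbσ)
theorem3 1 (s≤s ())
theorem3 2 (s≤s (s≤s ()))
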